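{- Let $\mathbf{t}=(t_1,\dots,t_n)$ be a sequence of positive integers and let $\lambda_i=t_i+t_{i+1}+\cdots+t_n$ for $1\le i\le n$. Then the number of distinct monomials in $$\Omega_n(\lambda)=\prod_{i=1}^n\sum_{j=1}^{\lambda_i}x_j$$ equals the number of lattice points $\#\Pi_n(t_1,\dots,t_{n-1},t_n-1)$ in the polytope $\Pi_n(t_1,\dots,t_{n-1},t_n-1)$.
   Context: For real numbers $s_1,\dots,s_n\ge 0$, the (Pitman–Stanley) polytope is $$\Pi_n(s_1,\dots,s_n)=\{\mathbf{y}\in\mathbb{R}^n:\ y_i\ge 0\text{ and }y_1+\cdots+y_i\le s_n+s_{n-1}+\cdots+s_{n-i+1}\text{ for all }1\le i\le n\}.$$ Lattice points are points of $\mathbb{Z}^n$. $\Omega_n(\lambda)$ is a polynomial with integer coefficients; its distinct monomials are those with nonzero coefficient. -}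

module Defs where

open import Data.Fin using (Fin; zero; suc; inject≤; fromℕ)
open import Data.Integer as ℤ using (ℤ; +_; 0ℤ; 1ℤ)
open import Data.List as List using (List; []; _∷_; _++_; length)
open import Data.List.Membership.Propositional using (_∈_)
open import Data.List.Relation.Unary.Unique.Propositional using (Unique)
open import Data.Nat as ℕ using (ℕ; zero; suc; _≤_; _∸_)
open import Data.Nat.Properties using (_≟_)
open import Data.Product using (_×_; _,_; proj₁; proj₂)
open import Data.Rational as ℚ using (ℚ; 0ℚ)
open import Data.Rational.Literals using (fromℤ)
open import Data.Vec as Vec using (Vec; []; _∷_; _[_]≔_; _[_]%=_)
open import Data.Vec.Properties using (≡-dec)
open import Function.Bundles using (_⇔_)
open import Level using (Level; _⊔_; 0ℓ)
open import Relation.Binary.PropositionalEquality using (_≡_; _≢_)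
open import Relation.Unary using (Pred)

private variable
  a ℓ : Level
  A   : Set a
  n N : ℕ

record HasCardinality {A : Set a} (P : Pred A ℓ) (k : ℕ) : Set (a ⊔ ℓ) where
  field
    elements : List A
    unique   : Unique elements
    complete : ∀ x → (x ∈ elements) ⇔ P x
    size     : length elements ≡ k

------------------------------------------------------------------------
-- ℤ[x₁,…,x_N]

-- Exponent vectors.
Monomial : ℕ → Set
Monomial N = Vec ℕ N

-- Formal sums of terms.  Like terms need not be collected, and terms may have
-- coefficient zero; `coeff` gives the coefficient after collection.
Polynomial : ℕ → Set
Polynomial N = List (ℤ × Monomial N)

coeff : Polynomial N → Monomial N → ℤ
coeff p m = List.foldr ℤ._+_ 0ℤ
  (List.map proj₁ (List.filter (λ term → ≡-dec _≟_ (proj₂ term) m) p))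

0ᴾ 1ᴾ : Polynomial N
0ᴾ = []
1ᴾ {N} = (1ℤ , Vec.replicate N 0) ∷ []

var : Fin N → Polynomial N
var {N} j = (1ℤ , Vec.replicate N 0 [ j ]≔ 1) ∷ []

_+ᴾ_ _*ᴾ_ : Polynomial N → Polynomial N → Polynomial N
p +ᴾ q = p ++ q
p *ᴾ q = List.cartesianProductWith
  (λ { (c , u) (d , v) → c ℤ.* d , Vec.zipWith ℕ._+_ u v }) p q

-- Indexed sum Σ_{j<k} f j and product Π_{i<k} f i.
∑ᴾ ∏ᴾ : ∀ k → (Fin k → Polynomial N) → Polynomial N
∑ᴾ k f = List.foldr _+ᴾ_ 0ᴾ (List.tabulate {n = k} f)
∏ᴾ k f = List.foldr _*ᴾ_ 1ᴾ (List.tabulate {n = k} f)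

MonomialOf : Polynomial N → Pred (Monomial N) 0ℓ
MonomialOf p m = coeff p m ≢ 0ℤ

-- ∏ᵢ (x₁ + ⋯ + x_{λᵢ}), in a polynomial ring with at least max λᵢ variables.
Ω : (λs : Fin n → ℕ) → (∀ i → λs i ≤ N) → Polynomial N
Ω {n} λs λs≤N = ∏ᴾ n (λ i → ∑ᴾ (λs i) (λ j → var (inject≤ j (λs≤N i))))

-- tᵢ + tᵢ₊₁ + ⋯ + tₙ
suffixSum : Vec ℕ n → Fin n → ℕ
suffixSum ts       zero    = Vec.sum ts
suffixSum (_ ∷ ts) (suc i) = suffixSum ts i

------------------------------------------------------------------------
-- The Pitman–Stanley polytope, over ℚ in place of ℝ: the real and rational
-- polytopes with the same rational parameters have the same points in ℤⁿ.

-- y₁ + ⋯ + yᵢ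
prefixSum : Vec ℚ n → Fin n → ℚ
prefixSum (y ∷ _)  zero    = y
prefixSum (y ∷ ys) (suc i) = y ℚ.+ prefixSum ys i

-- The i-th prefix sum of the reversal of s is sₙ + sₙ₋₁ + ⋯ + sₙ₋ᵢ₊₁.
Π : Vec ℚ n → Pred (Vec ℚ n) 0ℓ
Π s y = ∀ i → 0ℚ ℚ.≤ Vec.lookup y i
            × prefixSum y i ℚ.≤ prefixSum (Vec.reverse s) i

LatticePointOf : Pred (Vec ℚ n) ℓ → Pred (Vec ℤ n) ℓ
LatticePointOf P z = P (Vec.map fromℤ z)

-- (t₁, …, tₙ₋₁, tₙ − 1); the truncated subtraction is exact when tₙ > 0.
decrementLast : Vec ℕ (suc n) → Vec ℕ (suc n)
decrementLast {n} t = t [ fromℕ n ]%= (_∸ 1)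

toℚⁿ : Vec ℕ n → Vec ℚ n
toℚⁿ = Vec.map (λ k → fromℤ (+ k))

{-# OPTIONS --safe #-}

-- A monomial of Ω has degree m, the number of its factors, so it is x_{a₁} ⋯ x_{aₘ} with
-- a₁ ≤ ⋯ ≤ aₘ.  It occurs in Ω iff aᵢ ≤ λ_{m−i+1} for all i, because λ is weakly
-- decreasing, and all coefficients of Ω are positive.  The differences y₁ = a₁ − 1,
-- yᵢ = aᵢ − aᵢ₋₁ are then exactly the lattice points of the polytope.  Peeling the factors
-- off Ω one at a time corresponds to inserting an index into the sorted sequence a; in the
-- worst case it lands at the end, where the largest bound applies.
module Submission where

open import Defs
open import Data.Nat using (ℕ; suc; _≤_; _<_)
open import Data.Vec using (Vec)
open import Data.Vec.Relation.Unary.All using (All)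
open import Data.Product using (_×_; ∃-syntax)

open import Data.Empty using (⊥-elim)
open import Data.Fin using (Fin; zero; suc; toℕ; inject≤; fromℕ<)
open import Data.Fin.Properties using (toℕ-inject≤; toℕ-fromℕ<; toℕ<n)
open import Data.Integer as ℤ using (ℤ; 0ℤ; 1ℤ) renaming (+_ to pos)
import Data.Integer.Properties as ℤ
open import Data.List as List using (List; []; _∷_; length)
open import Data.List.Membership.Propositional using (_∈_)
open import Data.List.Membership.Propositional.Properties
open import Data.List.Properties using (length-map; filter-none)
open import Data.List.Relation.Unary.All as ListAll using ([]; _∷_)
import Data.List.Relation.Unary.All.Properties as ListAll
open import Data.List.Relation.Unary.AllPairs using ([]; _∷_)
open import Data.List.Relation.Unary.Any as Any using (here; there; any?)
open import Data.List.Relation.Unary.Unique.Propositional using (Unique)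
import Data.List.Relation.Unary.Unique.Propositional.Properties as Unique
open import Data.Nat as ℕ using (zero; _+_; _∸_; z≤n; s≤s; s≤s⁻¹)
open import Data.Nat.Properties
open import Data.Product using (∃; _,_; proj₁; proj₂)
open import Data.Rational as ℚ using (ℚ)
import Data.Rational.Properties as ℚ
open import Data.Rational.Literals using (fromℤ)
import Data.Rational.Unnormalised as ℚᵘ
import Data.Rational.Unnormalised.Properties as ℚᵘ
open import Data.Vec as Vec using ([]; _∷_; _∷ʳ_; _[_]%=_; _[_]≔_; initLast)
open import Data.Vec.Properties
  using (∷-injective; ≡-dec; lookup-map; map-∘; map-reverse; reverse-∷; zipWith-identityˡ)
open import Data.Vec.Relation.Unary.All using ([]; _∷_)
open import Function using (_∘_; case_of_)
open import Function.Bundles using (_⇔_; mk⇔; Equivalence)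
open import Level using (Level)
open import Relation.Binary.PropositionalEquality
open import Relation.Nullary using (Dec; yes; no)
open import Relation.Nullary.Decidable using (map′)
open import Relation.Unary using (Pred; Decidable)

open Equivalence using (to; from)

private variable
  a b ℓ ℓ′ : Level
  A : Set a
  B : Set b
  c k m n N s : ℕ

-- Cardinality

unique-map : {f : A → B} {xs : List A} →
  (∀ {x y} → x ∈ xs → y ∈ xs → f x ≡ f y → x ≡ y) → Unique xs → Unique (List.map f xs)
unique-map inj []       = []
unique-map inj (x∉ ∷ u) =
  ListAll.map⁺ (ListAll.tabulate λ y∈ eq →
    ListAll.lookup x∉ y∈ (inj (here refl) (there y∈) eq))
  ∷ unique-map (λ x∈ y∈ → inj (there x∈) (there y∈)) u

-- Injectivity is asked on `P` only: for `monomial N` it is available just for vectors whose sum is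
-- below `N`.
hasCardinality-image : {P : Pred A ℓ} {Q : Pred B ℓ′} (f : A → B) →
  (∀ {x y} → P x → P y → f x ≡ f y → x ≡ y) →
  (∀ z → Q z ⇔ ∃ λ x → P x × z ≡ f x) →
  HasCardinality P k → HasCardinality Q k
hasCardinality-image f inj image H = record
  { elements = List.map f elements
  ; unique   = unique-map
      (λ x∈ y∈ → inj (to (complete _) x∈) (to (complete _) y∈)) unique
  ; complete = λ z → mk⇔
      (λ z∈ → let x , x∈ , eq = ∈-map⁻ f z∈ in from (image z) (x , to (complete x) x∈ , eq))
      (λ q → let x , p , eq = to (image z) q in
        subst (_∈ _) (sym eq) (∈-map⁺ f (from (complete x) p)))
  ; size     = trans (length-map f elements) size
  } where open HasCardinality H

box : ∀ n → ℕ → List (Vec ℕ n)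
box zero    b = [] ∷ []
box (suc n) b = List.cartesianProductWith _∷_ (List.upTo (suc b)) (box n b)

box-unique : ∀ n b → Unique (box n b)
box-unique zero    b = [] ∷ []
box-unique (suc n) b =
  Unique.cartesianProductWith⁺ _∷_ ∷-injective (Unique.upTo⁺ (suc b)) (box-unique n b)

∈-box : ∀ {b} {ys : Vec ℕ n} → Vec.sum ys ≤ b → ys ∈ box n b
∈-box {ys = []}     _  = here refl
∈-box {ys = y ∷ ys} le = ∈-cartesianProductWith⁺ _∷_
  (∈-upTo⁺ (s≤s (≤-trans (m≤m+n y _) le)))
  (∈-box (≤-trans (m≤n+m _ y) le))

-- A bound on the sum bounds every entry, so filtering a finite box finds all of `P`.
hasCardinality-bounded : ∀ {b} {P : Pred (Vec ℕ n) ℓ} → Decidable P →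
  (∀ {ys} → P ys → Vec.sum ys ≤ b) → ∃[ k ] HasCardinality P k
hasCardinality-bounded {n = n} {b = b} P? bound = _ , record
  { elements = List.filter P? (box n b)
  ; unique   = Unique.filter⁺ P? (box-unique n b)
  ; complete = λ ys → mk⇔ (proj₂ ∘ ∈-filter⁻ P? {xs = box n b})
                          (λ p → ∈-filter⁺ P? (∈-box (bound p)) p)
  ; size     = refl
  }

-- Vectors with bounded prefix sums

-- y₁ + ⋯ + yᵢ ≤ c + s₁ + ⋯ + sᵢ for all i; the next slack c′ carries the difference.
data Bounded : ℕ → Vec ℕ n → Vec ℕ n → Set where
  []   : Bounded c [] []
  cons : ∀ {c′ y} {ss ys : Vec ℕ n} → y + c′ ≡ c + s → Bounded c′ ss ys →
         Bounded c (s ∷ ss) (y ∷ ys)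

bounded? : ∀ c (ss ys : Vec ℕ n) → Dec (Bounded c ss ys)
bounded? c []       []       = yes []
bounded? c (s ∷ ss) (y ∷ ys) with y ℕ.≤? c + s
... | no  y≰ = no λ { (cons eq _) → y≰ (subst (y ≤_) eq (m≤m+n y _)) }
... | yes y≤ = map′ (cons (m+[n∸m]≡n y≤))
  -- Cancelling `y` shows that the next slack can only be `c + s ∸ y`, so deciding the tail for this
  -- one value suffices.
  (λ { (cons eq p) → subst (λ c′ → Bounded c′ ss ys)
         (+-cancelˡ-≡ y _ _ (trans eq (sym (m+[n∸m]≡n y≤)))) p })
  (bounded? (c + s ∸ y) ss ys)

bounded-sum : ∀ {ss ys : Vec ℕ n} → Bounded c ss ys → Vec.sum ys ≤ c + Vec.sum ss
bounded-sum [] = z≤n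
bounded-sum {c = c} (cons {s = s} {c′ = c′} {y = y} {ss = ss} {ys = ys} eq p) = begin
  y + Vec.sum ys          ≤⟨ +-monoʳ-≤ y (bounded-sum p) ⟩
  y + (c′ + Vec.sum ss)   ≡⟨ +-assoc y c′ _ ⟨
  y + c′ + Vec.sum ss     ≡⟨ cong (_+ Vec.sum ss) eq ⟩
  c + s + Vec.sum ss      ≡⟨ +-assoc c s _ ⟩
  c + (s + Vec.sum ss)    ∎
  where open ≤-Reasoning

prefixSumℕ : Vec ℕ n → Fin n → ℕ
prefixSumℕ (y ∷ _)  zero    = y
prefixSumℕ (y ∷ ys) (suc i) = y + prefixSumℕ ys i

bounded⇒prefixSum≤ : ∀ {ss ys : Vec ℕ n} → Bounded c ss ys →
  ∀ i → prefixSumℕ ys i ≤ c + prefixSumℕ ss i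
bounded⇒prefixSum≤ (cons {y = y} eq p) zero = subst (y ≤_) eq (m≤m+n y _)
bounded⇒prefixSum≤ {c = c} (cons {s = s} {c′ = c′} {y = y} {ss = ss} {ys = ys} eq p) (suc i) =
  begin
  y + prefixSumℕ ys i          ≤⟨ +-monoʳ-≤ y (bounded⇒prefixSum≤ p i) ⟩
  y + (c′ + prefixSumℕ ss i)   ≡⟨ +-assoc y c′ _ ⟨
  y + c′ + prefixSumℕ ss i     ≡⟨ cong (_+ prefixSumℕ ss i) eq ⟩
  c + s + prefixSumℕ ss i      ≡⟨ +-assoc c s _ ⟩
  c + (s + prefixSumℕ ss i)    ∎
  where open ≤-Reasoning

prefixSum≤⇒bounded : ∀ c (ss ys : Vec ℕ n) →
  (∀ i → prefixSumℕ ys i ≤ c + prefixSumℕ ss i) → Bounded c ss ys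
prefixSum≤⇒bounded c []       []       le = []
prefixSum≤⇒bounded c (s ∷ ss) (y ∷ ys) le =
  cons eq (prefixSum≤⇒bounded c′ ss ys λ i → +-cancelˡ-≤ y _ _ (begin
    y + prefixSumℕ ys i          ≤⟨ le (suc i) ⟩
    c + (s + prefixSumℕ ss i)    ≡⟨ +-assoc c s _ ⟨
    c + s + prefixSumℕ ss i      ≡⟨ cong (_+ prefixSumℕ ss i) eq ⟨
    y + c′ + prefixSumℕ ss i     ≡⟨ +-assoc y c′ _ ⟩
    y + (c′ + prefixSumℕ ss i)   ∎))
  where
  open ≤-Reasoning
  c′ = c + s ∸ y
  eq : y + c′ ≡ c + s
  eq = m+[n∸m]≡n (le zero)

-- Insertion into a sorted sequence

incrementHead : Vec ℕ (suc n) → Vec ℕ (suc n)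
incrementHead ys = ys [ zero ]%= suc

-- If ys are the successive differences of a sorted sequence (starting from 0), then
-- `insert j ys` are those of the sequence with j inserted.
insert : ℕ → Vec ℕ n → Vec ℕ (suc n)
insert j       []           = j ∷ []
insert j       (zero ∷ ys)  = zero ∷ insert j ys
insert zero    (suc y ∷ ys) = zero ∷ suc y ∷ ys
insert (suc j) (suc y ∷ ys) = incrementHead (insert j (y ∷ ys))

-- The extra unit of the first difference is paid from the first budget `c + s`. What remains of it
-- is all in the slack `k`, hence the 0 in place of `s`.
bounded-incrementHead : ∀ {ss ys : Vec ℕ (suc n)} → suc k ≡ c + s →
  Bounded k (0 ∷ Vec.tail ss) ys → Bounded c (s ∷ Vec.tail ss) (incrementHead ys)
bounded-incrementHead {k = k} eq (cons eq′ p) =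
  cons (trans (cong suc (trans eq′ (+-identityʳ k))) eq) p

-- Each old entry moves one place to the right, where the bound is no smaller. Only `d = 0` is used
-- later, but the recursive call takes the displaced head `y` as its `d`.
bounded-shift : ∀ d {ss ys : Vec ℕ n} → Bounded c ss ys →
  Bounded (d + c) (ss ∷ʳ s) (d ∷ ys)
bounded-shift {c = c} {s = s} d [] = cons (sym (+-assoc d c s)) []
bounded-shift {c = c} d (cons {s = s₁} {c′ = c′} {y = y} eq p) =
  cons (trans (cong (d +_) eq) (sym (+-assoc d c s₁))) (bounded-shift y p)

-- Entries behind `j` move to later, weaker bounds. If `j` is not last, the larger entry that it
-- displaces already met the bound at that place; if it is last, the hypothesis on `j` is the bound.
bounded-insert : ∀ j {ss ys : Vec ℕ n} → Bounded c ss ys →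
  j ≤ c + Vec.sum (ss ∷ʳ s) → Bounded c (ss ∷ʳ s) (insert j ys)
bounded-insert {c = c} {s = s} j [] le =
  cons (m+[n∸m]≡n (subst (λ z → j ≤ c + z) (+-identityʳ s) le)) []
bounded-insert {c = c} j (cons {s = s₁} {y = zero} refl p) le =
  cons refl (bounded-insert j p (subst (j ≤_) (sym (+-assoc c s₁ _)) le))
bounded-insert zero (cons {y = suc y} eq p) le = bounded-shift zero (cons eq p)
bounded-insert {c = c} {s = s} (suc j) (cons {s = s₁} {c′ = c′} {y = suc y} {ss = ss} eq p) le =
  -- Lower `j` and the first difference by one together; the slack `y + c′` swallows the first
  -- bound, leaving 0.
  bounded-incrementHead {ss = 0 ∷ (ss ∷ʳ s)} eq
    (bounded-insert j (cons (sym (+-identityʳ (y + c′))) p) (s≤s⁻¹ (begin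
      suc j                              ≤⟨ le ⟩
      c + (s₁ + Vec.sum (ss ∷ʳ s))       ≡⟨ +-assoc c s₁ _ ⟨
      c + s₁ + Vec.sum (ss ∷ʳ s)         ≡⟨ cong (_+ Vec.sum (ss ∷ʳ s)) eq ⟨
      suc (y + c′ + Vec.sum (ss ∷ʳ s))   ∎)))
  where open ≤-Reasoning

bounded-init : ∀ (ss ys : Vec ℕ n) {y} → Bounded c (ss ∷ʳ s) (ys ∷ʳ y) → Bounded c ss ys
bounded-init []       []       _           = []
bounded-init (_ ∷ ss) (_ ∷ ys) (cons eq p) = cons eq (bounded-init ss ys p)

-- The sum of all differences is the last and largest entry, so it goes back to the end. Hence every
-- nonempty difference vector arises by an insertion.
insert-sum : ∀ (ys : Vec ℕ n) y → insert (Vec.sum (ys ∷ʳ y)) ys ≡ ys ∷ʳ y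
insert-sum []           y = cong (_∷ []) (+-identityʳ y)
insert-sum (zero ∷ ys)  y = cong (zero ∷_) (insert-sum ys y)
insert-sum (suc x ∷ ys) y = cong incrementHead (insert-sum (x ∷ ys) y)

-- Monomials of sorted sequences

-- The product of the variables with 0-based indices y₁, y₁ + y₂, y₁ + y₂ + y₃, …;
-- meaningful only if these are below N.
monomial : ∀ N → Vec ℕ m → Monomial N
monomial N       []           = Vec.replicate N 0
monomial zero    (_ ∷ _)      = []
monomial (suc N) (zero ∷ ys)  = incrementHead (monomial (suc N) ys)
monomial (suc N) (suc y ∷ ys) = 0 ∷ monomial N (y ∷ ys)

monomial-incrementHead : ∀ (ys : Vec ℕ (suc m)) →
  monomial (suc N) (incrementHead ys) ≡ 0 ∷ monomial N ys
monomial-incrementHead (_ ∷ _) = refl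

incrementHead-%= : ∀ (u : Monomial (suc N)) i →
  incrementHead (u [ i ]%= suc) ≡ incrementHead u [ i ]%= suc
incrementHead-%= (_ ∷ _) zero    = refl
incrementHead-%= (_ ∷ _) (suc i) = refl

-- Raising an exponent is multiplication by a variable; this ties `insert` to the factors of `Ω`.
monomial-insert : ∀ (i : Fin N) (ys : Vec ℕ m) →
  monomial N (insert (toℕ i) ys) ≡ monomial N ys [ i ]%= suc
monomial-insert zero    []           = refl
monomial-insert (suc i) []           = cong (0 ∷_) (monomial-insert i [])
monomial-insert {suc N} i (zero ∷ ys) =
  trans (cong incrementHead (monomial-insert i ys)) (incrementHead-%= (monomial (suc N) ys) i)
monomial-insert zero    (suc y ∷ ys) = refl
monomial-insert (suc i) (suc y ∷ ys) =
  trans (monomial-incrementHead (insert (toℕ i) (y ∷ ys)))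
        (cong (0 ∷_) (monomial-insert i (y ∷ ys)))

incrementHead-injective : ∀ {u v : Vec ℕ (suc n)} → incrementHead u ≡ incrementHead v → u ≡ v
incrementHead-injective {u = _ ∷ _} {_ ∷ _} refl = refl

incrementHead≢0∷ : ∀ {u : Vec ℕ (suc n)} {v} → incrementHead u ≢ 0 ∷ v
incrementHead≢0∷ {u = _ ∷ _} ()

-- The exponent of the first variable is positive when the head is zero and vanishes otherwise, so
-- the heads can be compared unit by unit. The bounds on the sums keep all indices in range.
monomial-injective : ∀ (ys zs : Vec ℕ m) → Vec.sum ys < N → Vec.sum zs < N →
  monomial N ys ≡ monomial N zs → ys ≡ zs
monomial-injective [] [] _ _ _ = refl
monomial-injective {N = suc N} (zero ∷ ys) (zero ∷ zs) p q eq =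
  cong (zero ∷_) (monomial-injective ys zs p q (incrementHead-injective eq))
monomial-injective {N = suc N} (suc y ∷ ys) (suc z ∷ zs) (s≤s p) (s≤s q) eq =
  cong incrementHead (monomial-injective (y ∷ ys) (z ∷ zs) p q (proj₂ (∷-injective eq)))
monomial-injective {N = suc N} (zero ∷ ys) (suc z ∷ zs) p q eq =
  ⊥-elim (incrementHead≢0∷ eq)
monomial-injective {N = suc N} (suc y ∷ ys) (zero ∷ zs) p q eq =
  ⊥-elim (incrementHead≢0∷ (sym eq))

-- Polynomials all of whose terms have coefficient 1

Monic : Polynomial N → Set
Monic = ListAll.All (λ term → proj₁ term ≡ 1ℤ)

module _ (u : Monomial N) where

  private
    hasMonomial? : Decidable (λ (term : ℤ × Monomial N) → proj₂ term ≡ u)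
    hasMonomial? term = ≡-dec _≟_ (proj₂ term) u

  sum-monic : {p : Polynomial N} → Monic p →
    List.foldr ℤ._+_ 0ℤ (List.map proj₁ p) ≡ pos (length p)
  sum-monic []         = refl
  sum-monic (refl ∷ p) = cong (λ z → 1ℤ ℤ.+ z) (sum-monic p)

  -- With unit coefficients no cancellation can occur.
  monomialOf⇔∈ : {p : Polynomial N} → Monic p → MonomialOf p u ⇔ ((1ℤ , u) ∈ p)
  monomialOf⇔∈ {p} monic = mk⇔ ⇒ ⇐
    where
    ⇒ : MonomialOf p u → (1ℤ , u) ∈ p
    ⇒ coeff≢0 with any? hasMonomial? p
    ... | yes has = find-term monic has
      where
      find-term : ∀ {q} → Monic q → Any.Any (λ term → proj₂ term ≡ u) q → (1ℤ , u) ∈ q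
      find-term (refl ∷ _) (here refl) = here refl
      find-term (_ ∷ q)    (there h)   = there (find-term q h)
    ... | no ¬has = ⊥-elim (coeff≢0 (cong (List.foldr ℤ._+_ 0ℤ ∘ List.map proj₁)
                      (filter-none hasMonomial? (ListAll.¬Any⇒All¬ p ¬has))))

    ⇐ : (1ℤ , u) ∈ p → MonomialOf p u
    -- The given term survives the filter, so the filtered list is nonempty and its coefficients add
    -- up to a positive length.
    ⇐ ∈p coeff≡0 with List.filter hasMonomial? p
                    | ∈-filter⁺ hasMonomial? ∈p refl
                    | ListAll.filter⁺ hasMonomial? monic
    ... | _ ∷ _ | _ | monic′ =
      case trans (sym (sum-monic monic′)) coeff≡0 of λ ()

module _ (p q : Polynomial N) where

  monic-*ᴾ : Monic p → Monic q → Monic (p *ᴾ q)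
  monic-*ᴾ mp mq = ListAll.tabulate λ x∈ →
    case ∈-cartesianProductWith⁻ _ p q x∈ of λ
      { (_ , _ , ∈p , ∈q , refl) →
          cong₂ ℤ._*_ (ListAll.lookup mp ∈p) (ListAll.lookup mq ∈q) }

  ∈-*ᴾ⁺ : ∀ {u v} → (1ℤ , u) ∈ p → (1ℤ , v) ∈ q → (1ℤ , Vec.zipWith _+_ u v) ∈ (p *ᴾ q)
  ∈-*ᴾ⁺ = ∈-cartesianProductWith⁺ _

  ∈-*ᴾ⁻ : Monic p → Monic q → ∀ {w} → (1ℤ , w) ∈ (p *ᴾ q) →
    ∃[ u ] ∃[ v ] (1ℤ , u) ∈ p × (1ℤ , v) ∈ q × w ≡ Vec.zipWith _+_ u v
  ∈-*ᴾ⁻ mp mq w∈ with ∈-cartesianProductWith⁻ _ p q w∈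
  ... | (_ , u) , (_ , v) , ∈p , ∈q , eq
    with refl ← ListAll.lookup mp ∈p | refl ← ListAll.lookup mq ∈q =
    u , v , ∈p , ∈q , cong proj₂ eq

-- Peeling a factor off Ω

varSum : k ≤ N → Polynomial N
varSum {k} k≤N = ∑ᴾ k (λ j → var (inject≤ j k≤N))

∈-varSum⁺ : ∀ (k≤N : k ≤ N) j →
  (1ℤ , Vec.replicate N 0 [ inject≤ j k≤N ]≔ 1) ∈ varSum k≤N
∈-varSum⁺ k≤N j = ∈-concat⁺′ (here refl) (∈-tabulate⁺ j)

∈-varSum⁻ : ∀ (k≤N : k ≤ N) {term} → term ∈ varSum k≤N →
  ∃[ j ] term ≡ (1ℤ , Vec.replicate N 0 [ inject≤ j k≤N ]≔ 1)
∈-varSum⁻ k≤N ∈p with ∈-concat⁻′ _ ∈p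
... | _ , ∈v , v∈ with ∈-tabulate⁻ {f = λ j → var (inject≤ j k≤N)} v∈
∈-varSum⁻ k≤N ∈p | _ , here eq , _ | j , refl = j , eq

monic-varSum : ∀ (k≤N : k ≤ N) → Monic (varSum k≤N)
monic-varSum k≤N = ListAll.tabulate λ ∈p → cong proj₁ (proj₂ (∈-varSum⁻ k≤N ∈p))

monic-Ω : ∀ {λs : Fin n → ℕ} (λ≤N : ∀ i → λs i ≤ N) → Monic (Ω λs λ≤N)
monic-Ω {n = zero}  λ≤N = refl ∷ []
monic-Ω {n = suc n} λ≤N =
  monic-*ᴾ (varSum (λ≤N zero)) _ (monic-varSum (λ≤N zero)) (monic-Ω (λ≤N ∘ suc))

var-*-monomial : ∀ (i : Fin N) u →
  Vec.zipWith _+_ (Vec.replicate N 0 [ i ]≔ 1) u ≡ u [ i ]%= suc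
var-*-monomial zero    (x ∷ u) = cong (suc x ∷_) (zipWith-identityˡ +-identityˡ u)
var-*-monomial (suc i) (x ∷ u) = cong (x ∷_) (var-*-monomial i u)

module _ {λs : Fin (suc n) → ℕ} (λ≤N : ∀ i → λs i ≤ N) where

  private
    λ₀≤N   = λ≤N zero
    Ω-head = varSum λ₀≤N
    Ω-tail = Ω (λs ∘ suc) (λ≤N ∘ suc)

  ∈-Ω-suc⁻ : ∀ {w} → (1ℤ , w) ∈ Ω λs λ≤N →
    ∃[ j ] ∃[ u ] (1ℤ , u) ∈ Ω-tail × w ≡ u [ inject≤ j λ₀≤N ]%= suc
  ∈-Ω-suc⁻ w∈
    with _ , u , v∈ , u∈ , refl ←
           ∈-*ᴾ⁻ Ω-head Ω-tail (monic-varSum λ₀≤N) (monic-Ω (λ≤N ∘ suc)) w∈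
    with j , refl ← ∈-varSum⁻ λ₀≤N v∈
    = j , u , u∈ , var-*-monomial (inject≤ j λ₀≤N) u

  ∈-Ω-suc⁺ : ∀ j {u} → (1ℤ , u) ∈ Ω-tail → (1ℤ , u [ inject≤ j λ₀≤N ]%= suc) ∈ Ω λs λ≤N
  ∈-Ω-suc⁺ j {u} u∈ = subst (λ v → (1ℤ , v) ∈ Ω λs λ≤N) (var-*-monomial (inject≤ j λ₀≤N) u)
    (∈-*ᴾ⁺ Ω-head Ω-tail (∈-varSum⁺ λ₀≤N j) u∈)

BoundedMonomial : Vec ℕ m → Pred (Monomial N) _
BoundedMonomial {N = N} ss u = ∃[ ys ] Bounded 0 ss ys × u ≡ monomial N ys

-- Forwards, the index chosen from the head factor is inserted. Backwards, the largest index is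
-- assigned to the head factor, whose range reaches the bound on the total sum. The `suc` appears
-- because indices start at 0.
∈-Ω-extend : ∀ {λs : Fin (suc n) → ℕ} (λ≤N : ∀ i → λs i ≤ N) (ss : Vec ℕ m) s →
  λs zero ≡ suc (Vec.sum (ss ∷ʳ s)) →
  (∀ u → ((1ℤ , u) ∈ Ω (λs ∘ suc) (λ≤N ∘ suc)) ⇔ BoundedMonomial ss u) →
  ∀ u → ((1ℤ , u) ∈ Ω λs λ≤N) ⇔ BoundedMonomial (ss ∷ʳ s) u
∈-Ω-extend {N = N} {λs = λs} λ≤N ss s λ₀≡ IH w = mk⇔ ⇒ ⇐
  where
  ⇒ : (1ℤ , w) ∈ Ω λs λ≤N → BoundedMonomial (ss ∷ʳ s) w
  ⇒ w∈ with j , u , u∈ , refl ← ∈-Ω-suc⁻ λ≤N w∈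
       with ys , p , refl ← to (IH u) u∈
    = insert (toℕ i) ys , bounded-insert (toℕ i) p i≤ , sym (monomial-insert i ys)
    where
    i = inject≤ j (λ≤N zero)
    i≤ : toℕ i ≤ Vec.sum (ss ∷ʳ s)
    i≤ = s≤s⁻¹ (subst₂ _<_ (sym (toℕ-inject≤ j (λ≤N zero))) λ₀≡ (toℕ<n j))

  ⇐ : BoundedMonomial (ss ∷ʳ s) w → (1ℤ , w) ∈ Ω λs λ≤N
  -- Dropping the last difference removes the largest index, `Vec.sum (ys ∷ʳ y)`.
  ⇐ (ys′ , p , refl) with ys , y , refl ← initLast ys′ =
    subst (λ u → (1ℤ , u) ∈ Ω λs λ≤N) (begin
      monomial N ys [ i ]%= suc                   ≡⟨ monomial-insert i ys ⟨
      monomial N (insert (toℕ i) ys)              ≡⟨ cong (λ k → monomial N (insert k ys)) toℕ-i ⟩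
      monomial N (insert (Vec.sum (ys ∷ʳ y)) ys)  ≡⟨ cong (monomial N) (insert-sum ys y) ⟩
      monomial N (ys ∷ʳ y)                        ∎)
    (∈-Ω-suc⁺ λ≤N j (from (IH _) (ys , bounded-init ss ys p , refl)))
    where
    open ≡-Reasoning
    sum<λ₀ : Vec.sum (ys ∷ʳ y) < λs zero
    sum<λ₀ = subst (Vec.sum (ys ∷ʳ y) <_) (sym λ₀≡) (s≤s (bounded-sum p))
    j = fromℕ< sum<λ₀
    i = inject≤ j (λ≤N zero)
    toℕ-i : toℕ i ≡ Vec.sum (ys ∷ʳ y)
    toℕ-i = trans (toℕ-inject≤ j (λ≤N zero)) (toℕ-fromℕ< sum<λ₀)

-- The bounds given by t

-- For positive entries its prefix sums are λₙ - 1, ..., λ₁ - 1: the largest 0-based indices in the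
-- factors of `Ω`, last factor first.
gaps : Vec ℕ (suc n) → Vec ℕ (suc n)
gaps t = Vec.reverse (decrementLast t)

gaps-∷ : ∀ t (ts : Vec ℕ (suc n)) → gaps (t ∷ ts) ≡ gaps ts ∷ʳ t
gaps-∷ t ts = reverse-∷ t (decrementLast ts)

sum-∷ʳ : ∀ (ss : Vec ℕ n) s → Vec.sum (ss ∷ʳ s) ≡ s + Vec.sum ss
sum-∷ʳ []       s = refl
sum-∷ʳ (x ∷ ss) s = begin
  x + Vec.sum (ss ∷ʳ s)  ≡⟨ cong (x +_) (sum-∷ʳ ss s) ⟩
  x + (s + Vec.sum ss)   ≡⟨ +-assoc x s _ ⟨
  x + s + Vec.sum ss     ≡⟨ cong (_+ Vec.sum ss) (+-comm x s) ⟩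
  s + x + Vec.sum ss     ≡⟨ +-assoc s x _ ⟩
  s + (x + Vec.sum ss)   ∎
  where open ≡-Reasoning

sum-gaps : ∀ (t : Vec ℕ (suc n)) → All (0 <_) t → Vec.sum t ≡ suc (Vec.sum (gaps t))
sum-gaps (suc t ∷ [])     _           = refl
sum-gaps (t ∷ ts@(_ ∷ _)) (_ ∷ ts>0)  = begin
  t + Vec.sum ts               ≡⟨ cong (t +_) (sum-gaps ts ts>0) ⟩
  t + suc (Vec.sum (gaps ts))  ≡⟨ +-suc t _ ⟩
  suc (t + Vec.sum (gaps ts))  ≡⟨ cong suc (sum-∷ʳ (gaps ts) t) ⟨
  suc (Vec.sum (gaps ts ∷ʳ t)) ≡⟨ cong (suc ∘ Vec.sum) (gaps-∷ t ts) ⟨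
  suc (Vec.sum (gaps (t ∷ ts))) ∎
  where open ≡-Reasoning

∈-Ω⇔boundedMonomial : ∀ (t : Vec ℕ (suc n)) → All (0 <_) t →
  (λ≤N : ∀ i → suffixSum t i ≤ N) → ∀ u →
  ((1ℤ , u) ∈ Ω (suffixSum t) λ≤N) ⇔ BoundedMonomial (gaps t) u
∈-Ω⇔boundedMonomial (t ∷ []) t>0 λ≤N =
  -- The single factor extends the empty product `1ᴾ`, whose only term is the zero exponent vector.
  ∈-Ω-extend λ≤N [] (t ∸ 1) (sum-gaps (t ∷ []) t>0) λ u → mk⇔
    (λ { (here refl) → [] , [] , refl })
    (λ { ([] , [] , refl) → here refl })
∈-Ω⇔boundedMonomial (t ∷ ts@(_ ∷ _)) t>0@(_ ∷ ts>0) λ≤N =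
  subst (λ ss → ∀ u → ((1ℤ , u) ∈ Ω (suffixSum (t ∷ ts)) λ≤N) ⇔ BoundedMonomial ss u)
    (sym (gaps-∷ t ts))
    (∈-Ω-extend λ≤N (gaps ts) t
      (trans (sum-gaps (t ∷ ts) t>0) (cong (suc ∘ Vec.sum) (gaps-∷ t ts)))
      (∈-Ω⇔boundedMonomial ts ts>0 (λ≤N ∘ suc)))

-- Lattice points

fromℕℚ : ℕ → ℚ
fromℕℚ k = fromℤ (pos k)

-- Addition in ℚ normalises by a gcd and does not reduce on variables; among unnormalised rationals
-- equality is cross-multiplication, here with all denominators 1.
fromℕℚ-+ : ∀ k m → fromℕℚ k ℚ.+ fromℕℚ m ≡ fromℕℚ (k + m)
fromℕℚ-+ k m = ℚ.toℚᵘ-injective (ℚᵘ.≃-trans (ℚ.toℚᵘ-homo-+ (fromℕℚ k) (fromℕℚ m))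
  (ℚᵘ.*≡* (cong (ℤ._* 1ℤ) (cong₂ ℤ._+_ (ℤ.*-identityʳ (pos k)) (ℤ.*-identityʳ (pos m))))))

fromℤ-mono-≤ : ∀ {i j} → i ℤ.≤ j → fromℤ i ℚ.≤ fromℤ j
fromℤ-mono-≤ le = ℚ.*≤* (subst₂ ℤ._≤_ (sym (ℤ.*-identityʳ _)) (sym (ℤ.*-identityʳ _)) le)

fromℤ-cancel-≤ : ∀ {i j} → fromℤ i ℚ.≤ fromℤ j → i ℤ.≤ j
fromℤ-cancel-≤ (ℚ.*≤* le) = subst₂ ℤ._≤_ (ℤ.*-identityʳ _) (ℤ.*-identityʳ _) le

prefixSum-toℚⁿ : ∀ (ys : Vec ℕ n) i → prefixSum (toℚⁿ ys) i ≡ fromℕℚ (prefixSumℕ ys i)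
prefixSum-toℚⁿ (y ∷ ys) zero    = refl
prefixSum-toℚⁿ (y ∷ ys) (suc i) =
  trans (cong (λ q → fromℕℚ y ℚ.+ q) (prefixSum-toℚⁿ ys i)) (fromℕℚ-+ y (prefixSumℕ ys i))

Π⇔bounded : ∀ (s ys : Vec ℕ n) → Π (toℚⁿ s) (toℚⁿ ys) ⇔ Bounded 0 (Vec.reverse s) ys
Π⇔bounded s ys = mk⇔
  (λ π → prefixSum≤⇒bounded 0 _ ys λ i → ℤ.drop‿+≤+ (fromℤ-cancel-≤
    (subst₂ ℚ._≤_ (prefixSum-toℚⁿ ys i) (bound i) (proj₂ (π i)))))
  (λ p i →
    subst (ℚ.0ℚ ℚ.≤_) (sym (lookup-map i fromℕℚ ys)) (fromℤ-mono-≤ (ℤ.+≤+ z≤n)) ,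
    subst₂ ℚ._≤_ (sym (prefixSum-toℚⁿ ys i)) (sym (bound i))
      (fromℤ-mono-≤ (ℤ.+≤+ (bounded⇒prefixSum≤ p i))))
  where
  bound : ∀ i → prefixSum (Vec.reverse (toℚⁿ s)) i ≡ fromℕℚ (prefixSumℕ (Vec.reverse s) i)
  bound i = trans (cong (λ v → prefixSum v i) (sym (map-reverse fromℕℚ s)))
                  (prefixSum-toℚⁿ (Vec.reverse s) i)

nonNegative⇒map-pos : (z : Vec ℤ n) → (∀ i → ℚ.0ℚ ℚ.≤ Vec.lookup (Vec.map fromℤ z) i) →
  ∃[ ys ] z ≡ Vec.map pos ys
nonNegative⇒map-pos []       _   = [] , refl
nonNegative⇒map-pos (x ∷ xs) 0≤z
  -- Only `+≤+` can prove `0ℤ ≤ x`, which forces `x` to be a `pos y`.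
  with pos y ← x | ℤ.+≤+ _ ← fromℤ-cancel-≤ {0ℤ} {x} (0≤z zero)
     | ys , refl ← nonNegative⇒map-pos xs (0≤z ∘ suc)
  = y ∷ ys , refl

latticePoint⇔bounded : ∀ (s : Vec ℕ n) z →
  LatticePointOf (Π (toℚⁿ s)) z ⇔ (∃[ ys ] Bounded 0 (Vec.reverse s) ys × z ≡ Vec.map pos ys)
latticePoint⇔bounded s z = mk⇔
  (λ π → case nonNegative⇒map-pos z (proj₁ ∘ π) of λ
    { (ys , refl) →
        ys , to (Π⇔bounded s ys) (subst (Π (toℚⁿ s)) (sym (map-∘ fromℤ pos ys)) π) , refl })
  (λ { (ys , p , refl) → subst (Π (toℚⁿ s)) (map-∘ fromℤ pos ys) (from (Π⇔bounded s ys) p) })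

map-pos-injective : ∀ {ys zs : Vec ℕ n} → Vec.map pos ys ≡ Vec.map pos zs → ys ≡ zs
map-pos-injective {ys = []}    {[]}    _  = refl
map-pos-injective {ys = _ ∷ _} {_ ∷ _} eq =
  let y≡z , ys≡zs = ∷-injective eq in cong₂ _∷_ (ℤ.+-injective y≡z) (map-pos-injective ys≡zs)

corollary4p7 : ∀ {n} (t : Vec ℕ (suc n)) → All (0 <_) t →
    ∀ {N} (λ≤N : ∀ i → suffixSum t i ≤ N) →
    ∃[ k ] HasCardinality (MonomialOf (Ω (suffixSum t) λ≤N)) k
    × HasCardinality (LatticePointOf (Π (toℚⁿ (decrementLast t)))) k
corollary4p7 t t>0 {N} λ≤N =
  -- The vectors bounded by `gaps t` are counted once; both sets are injective images of them.
  let k , card = hasCardinality-bounded (bounded? 0 (gaps t)) bounded-sum in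
  k , hasCardinality-image (monomial N)
        (λ p q → monomial-injective _ _ (sum<N p) (sum<N q)) monomials card
    , hasCardinality-image (Vec.map pos)
        (λ _ _ → map-pos-injective) (latticePoint⇔bounded (decrementLast t)) card
  where
  -- The largest index is below λ₁, and λ₁ is at most `N`.
  sum<N : ∀ {ys} → Bounded 0 (gaps t) ys → Vec.sum ys < N
  sum<N p = ≤-trans (s≤s (bounded-sum p))
    (≤-trans (≤-reflexive (sym (sum-gaps t t>0))) (λ≤N zero))

  monomials : ∀ u → MonomialOf (Ω (suffixSum t) λ≤N) u ⇔ BoundedMonomial (gaps t) u
  monomials u = mk⇔
    (to (∈-Ω⇔boundedMonomial t t>0 λ≤N u) ∘ to (monomialOf⇔∈ u (monic-Ω λ≤N)))
    (from (monomialOf⇔∈ u (monic-Ω λ≤N)) ∘ from (∈-Ω⇔boundedMonomial t t>0 λ≤N u))
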